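{- AC is a decision procedure for $\mathrm{CSP}_{\overline{SP}}(\mathrm{EMC})$.
   Context: Patterns. A pattern is a tuple $\langle X,D,A,\mathrm{cpt},<_X,<_D\rangle$ where $X$ is a finite set of variables; $D$ is a finite set of values; $A\subseteq X\times D$ is the set of points, with $D(x)=\{a\in D\mid \langle x,a\rangle\in A\}$ non-empty for every $x\in X$; $\mathrm{cpt}$ is a partial function from the set of unordered pairs of points $\{\langle x,a\rangle,\langle y,b\rangle\}$ with $x\neq y$ to $\{\mathrm{TRUE},\mathrm{FALSE}\}$; $<_X$ and $<_D$ are (possibly partial, possibly empty) strict orders on $X$ and $D$. Pairs of points with $\mathrm{cpt}=\mathrm{TRUE}$ (FALSE) are called positive (negative) edges. Instances. A (binary CSP) instance is a pattern $\langle X,D,A,\mathrm{cpt}\rangle$ without orders, with $\mathrm{cpt}$ total on all unordered pairs of points belonging to distinct variables. $R_{x,y}=\{\langle a,b\rangle\in D(x)\times D(y)\mid \mathrm{cpt}(\langle x,a\rangle,\langle y,b\rangle)=\mathrm{TRUE}\}$. A solution is a map $s:X\to D$ with $s(x)\in D(x)$ and $\langle s(x),s(y)\rangle\in R_{x,y}$ for all $x\neq y$. Occurrence. A homomorphism from $P'=\langle X',D',A',\mathrm{cpt}',<_{X'},<_{D'}\rangle$ to $P=\langle X,D,A,\mathrm{cpt},<_X,<_D\rangle$ is a (not necessarily injective) map $f:A'\to A$ such that: if $\mathrm{cpt}'(p,q)$ is defined then $\mathrm{cpt}(f(p),f(q))=\mathrm{cpt}'(p,q)$; the map $f_{var}:X'\to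 X$ given by $f_{var}(x')=x$ if $f(\langle x',a'\rangle)=\langle x,a\rangle$ for some $a',a$ is well-defined and injective; $x'<_{X'}y'$ implies $f_{var}(x')<_X f_{var}(y')$; and if $a',b'\in D'(x')$, $a'<_{D'}b'$, $f(\langle x',a'\rangle)=\langle x,a\rangle$, $f(\langle x',b'\rangle)=\langle x,b\rangle$, then $a<_D b$. A pattern $P$ occurs in an instance $I$ if for every pair of total orders on the variables and on the values of $I$ there is a homomorphism from $P$ to $I$ equipped with these orders. $\mathrm{CSP}_{\overline{SP}}(P)$ is the set of instances in which $P$ does not occur (i.e. instances for which there exist total orders on the variables and on the values such that $P$ has no homomorphism to the instance equipped with them). Arc consistency. A point $\langle x,a\rangle$ of an instance is arc consistent if for every variable $y\neq x$ there is a point $\langle y,b\rangle$ compatible with it ($\mathrm{cpt}=\mathrm{TRUE}$). Establishing arc consistency means repeatedly removing points that are not arc consistent. AC is a decision procedure for a class of instances if for every instance of the class, non-emptiness of all domains after establishing arc consistency guarantees that the instance has a solution. The pattern $\mathrm{EMC}$ (Extended Max-Closed): variables $x,y,z$ with pairwise disjoint domains $D(x)=\{\epsilon\}$, $D(y)=\{\alpha,\beta\}$, $D(z)=\{\gamma,\delta\}$ (each value stands for its point); negative edges $\alpha\gamma$, $\epsilon\delta$; positive edges $\alpha\delta$, $\beta\gamma$, $\alpha\epsilon$, $\epsilon\gamma$; no other pair of points has defined compatibility; variable order $y<z$; domain order $\alpha>\beta$, $\gamma>\delta$. -}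

module Defs where

open import Data.Bool using (Bool; true; false)
import Data.Bool.Properties as Bool
open import Data.Fin using (Fin; zero; suc)
open import Data.Fin.Properties using (all?)
open import Data.Fin.Subset using (Subset; _∈_; _∪_; _-_; ⁅_⁆; Nonempty)
open import Data.Fin.Subset.Properties using (_∈?_; x∈⁅x⁆; x∈p∪q⁺)
open import Data.Maybe using (Maybe; just; nothing; Is-just)
import Data.Maybe.Properties as Maybe
open import Data.Nat using (ℕ)
open import Data.Product using (_×_; _,_; ∃)
open import Data.Sum using (inj₁)
open import Data.Vec.Functional using (updateAt)
open import Function.Definitions using (Injective)
open import Level using (Level; 0ℓ) renaming (suc to lsuc)
open import Relation.Binary using (Rel; IsStrictPartialOrder; IsStrictTotalOrder)
open import Relation.Binary.Construct.Closure.ReflexiveTransitive using (Star)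
open import Relation.Binary.PropositionalEquality
  using (_≡_; _≢_; refl; resp₂; isEquivalence)
open import Relation.Nullary using (¬_; Dec)
open import Relation.Nullary.Decidable using (from-yes; _→-dec_)
open import Relation.Unary using (Pred)

record Point {n d : ℕ} (D : Fin n → Subset d) : Set where
  constructor point
  field
    var  : Fin n
    val  : Fin d
    val∈ : val ∈ D var

open Point public

-- A pattern without its two orders.  The set of points A ⊆ X × D is given
-- by the domains D(x).  A function on unordered pairs of points is a
-- symmetric function of two points, and `nothing` means "undefined".

record Unordered : Set where
  field
    #vars    : ℕ
    #vals    : ℕ
    domain   : Fin #vars → Subset #vals
    nonempty : ∀ x → Nonempty (domain x)
    cpt      : Point domain → Point domain → Maybe Bool
    cpt-sym  : ∀ p q → cpt p q ≡ cpt q p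
    cpt-same : ∀ p q → var p ≡ var q → cpt p q ≡ nothing

record Pattern : Set₁ where
  field
    unordered : Unordered
  open Unordered unordered public
  field
    _<X_     : Rel (Fin #vars) 0ℓ
    _<D_     : Rel (Fin #vals) 0ℓ
    <X-order : IsStrictPartialOrder _≡_ _<X_
    <D-order : IsStrictPartialOrder _≡_ _<D_

record Instance : Set where
  field
    unordered : Unordered
  open Unordered unordered public
  field
    cpt-total : ∀ p q → var p ≢ var q → Is-just (cpt p q)

record Solution (I : Instance) : Set where
  open Instance I
  field
    s          : Fin #vars → Fin #vals
    s∈         : ∀ x → s x ∈ domain x
    compatible : ∀ x y → x ≢ y →
                 cpt (point x (s x) (s∈ x)) (point y (s y) (s∈ y)) ≡ just true

-- Domains are non-empty, so the relation defining f_var is total; it is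
-- therefore well-defined exactly when some function fvar satisfies
-- fvar-def, and fvar is then determined by f.

record Homomorphism (P′ P : Pattern) : Set where
  private
    module P′ = Pattern P′
    module P  = Pattern P
  field
    f         : Point P′.domain → Point P.domain
    f-cpt     : ∀ p q {t} → P′.cpt p q ≡ just t → P.cpt (f p) (f q) ≡ just t
    fvar      : Fin P′.#vars → Fin P.#vars
    fvar-def  : ∀ p → fvar (var p) ≡ var (f p)
    fvar-inj  : Injective _≡_ _≡_ fvar
    fvar-mono : ∀ {x y} → x P′.<X y → fvar x P.<X fvar y
    f-mono    : ∀ p q → var p ≡ var q → val p P′.<D val q →
                val (f p) P.<D val (f q)

module _ (I : Instance) where
  open Instance I

  equip : {_<X_ : Rel (Fin #vars) 0ℓ} {_<D_ : Rel (Fin #vals) 0ℓ} →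
          IsStrictTotalOrder _≡_ _<X_ → IsStrictTotalOrder _≡_ _<D_ → Pattern
  equip {_<X_} {_<D_} totalX totalD = record
    { unordered = unordered
    ; _<X_      = _<X_
    ; _<D_      = _<D_
    ; <X-order  = IsStrictTotalOrder.isStrictPartialOrder totalX
    ; <D-order  = IsStrictTotalOrder.isStrictPartialOrder totalD
    }

_OccursIn_ : Pattern → Instance → Set₁
P OccursIn I =
  {_<X_ : Rel (Fin #vars) 0ℓ} {_<D_ : Rel (Fin #vals) 0ℓ}
  (totalX : IsStrictTotalOrder _≡_ _<X_)
  (totalD : IsStrictTotalOrder _≡_ _<D_) →
  Homomorphism P (equip I totalX totalD)
  where open Instance I

-- The literal negation of occurrence: constructively weaker than exhibiting
-- two total orders that admit no homomorphism.

CSP-SP : Pattern → Pred Instance (lsuc 0ℓ)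
CSP-SP P I = ¬ (P OccursIn I)

module _ (I : Instance) where
  open Instance I

  Remaining : Set
  Remaining = Fin #vars → Subset #vals

  _isIn_ : Point domain → Remaining → Set
  p isIn B = val p ∈ B (var p)

  ArcConsistent : Remaining → Point domain → Set
  ArcConsistent B p = ∀ y → y ≢ var p →
    ∃ λ q → var q ≡ y × q isIn B × cpt p q ≡ just true

  data _⟶_ (B : Remaining) : Remaining → Set where
    remove : ∀ p → p isIn B → ¬ ArcConsistent B p →
             B ⟶ updateAt B (var p) (_- val p)

  -- B is a result of establishing arc consistency: it is reached from the
  -- full domains by successive removals, and no removal is possible in B.
  Establishes-AC : Remaining → Set
  Establishes-AC B =
    Star _⟶_ domain B × (∀ p → p isIn B → ArcConsistent B p)

AC-Decides : {ℓ : Level} → Pred Instance ℓ → Set ℓ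
AC-Decides C = ∀ I → C I → ∀ B → Establishes-AC I B →
               (∀ x → Nonempty (B x)) → Solution I

module EMC where

  pattern x = zero
  pattern y = suc zero
  pattern z = suc (suc zero)

  pattern ε = zero
  pattern α = suc zero
  pattern β = suc (suc zero)
  pattern γ = suc (suc (suc zero))
  pattern δ = suc (suc (suc (suc zero)))

  domain : Fin 3 → Subset 5
  domain x = ⁅ ε ⁆
  domain y = ⁅ α ⁆ ∪ ⁅ β ⁆
  domain z = ⁅ γ ⁆ ∪ ⁅ δ ⁆

  nonempty : ∀ v → Nonempty (domain v)
  nonempty x = ε , x∈⁅x⁆ ε
  nonempty y = α , x∈p∪q⁺ {p = ⁅ α ⁆} {q = ⁅ β ⁆} (inj₁ (x∈⁅x⁆ α))
  nonempty z = γ , x∈p∪q⁺ {p = ⁅ γ ⁆} {q = ⁅ δ ⁆} (inj₁ (x∈⁅x⁆ γ))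

  -- The domains are pairwise disjoint, so a value identifies its point.
  edge : Fin 5 → Fin 5 → Maybe Bool
  edge α γ = just false
  edge γ α = just false
  edge ε δ = just false
  edge δ ε = just false
  edge α δ = just true
  edge δ α = just true
  edge β γ = just true
  edge γ β = just true
  edge α ε = just true
  edge ε α = just true
  edge ε γ = just true
  edge γ ε = just true
  edge _ _ = nothing

  private
    _≟_ : (s t : Maybe Bool) → Dec (s ≡ t)
    _≟_ = Maybe.≡-dec Bool._≟_

  edge-sym : ∀ a b → edge a b ≡ edge b a
  edge-sym = from-yes (all? λ a → all? λ b → edge a b ≟ edge b a)

  edge-same : ∀ v a b → a ∈ domain v → b ∈ domain v → edge a b ≡ nothing
  edge-same = from-yes (all? λ v → all? λ a → all? λ b →
    (a ∈? domain v) →-dec ((b ∈? domain v) →-dec (edge a b ≟ nothing)))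

  data _<X_ : Rel (Fin 3) 0ℓ where
    y<z : y <X z

  data _<D_ : Rel (Fin 5) 0ℓ where
    β<α : β <D α
    δ<γ : δ <D γ

  <X-order : IsStrictPartialOrder _≡_ _<X_
  <X-order = record
    { isEquivalence = isEquivalence
    ; irrefl        = λ { refl () }
    ; trans         = λ { y<z () }
    ; <-resp-≈      = resp₂ _<X_
    }

  <D-order : IsStrictPartialOrder _≡_ _<D_
  <D-order = record
    { isEquivalence = isEquivalence
    ; irrefl        = λ { refl () }
    ; trans         = λ { β<α () ; δ<γ () }
    ; <-resp-≈      = resp₂ _<D_
    }

EMC : Pattern
EMC = record
  { unordered = record
    { #vars    = 3
    ; #vals    = 5
    ; domain   = EMC.domain
    ; nonempty = EMC.nonempty
    ; cpt      = λ p q → EMC.edge (val p) (val q)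
    ; cpt-sym  = λ p q → EMC.edge-sym (val p) (val q)
    ; cpt-same = λ { (point v a a∈) (point .v b b∈) refl →
                     EMC.edge-same v a b a∈ b∈ }
    }
  ; _<X_     = EMC._<X_
  ; _<D_     = EMC._<D_
  ; <X-order = EMC.<X-order
  ; <D-order = EMC.<D-order
  }

{-# OPTIONS --safe #-}

-- Treat the variables in the order <X and let s(j) be the <D-greatest value
-- of B(j) that is compatible with s(m) for every m <X j.  To see that such a
-- value exists, let e be the greatest, over m <X j, of the least values of
-- B(j) compatible with s(m), and suppose that s(k) is incompatible with e for
-- some k <X j.  A support b of e at k is not below s(k), since otherwise EMC
-- occurs on j, k and the variable that gave e.  If b is above s(k), then by
-- the choice of s(k) some s(m) with m <X k is incompatible with b, and the
-- argument repeats with (k , b) and m in place of (j , e) and k.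
module Submission where

open import Defs

import Data.Bool.Properties as Bool
open import Data.Bool using (true; false)
open import Data.Fin using (Fin; finToFun; funToFin)
open import Data.Fin.Induction using (Acc; acc; spo-wellFounded; spo-noetherian)
open import Data.Fin.Properties using (any?; all?; _≟_; finToFun-funToFin)
open import Data.Fin.Subset using (Subset; _∈_; _⊆_; Nonempty)
open import Data.Fin.Subset.Properties using (_∈?_; p─q⊆p)
open import Data.Maybe using (just)
import Data.Maybe.Properties as Maybe
open import Data.Product using (_×_; _,_; ∃; proj₁; proj₂)
open import Data.Unit using (⊤; tt)
open import Data.Vec.Functional using (updateAt)
open import Data.Vec.Functional.Properties using (updateAt-updates; updateAt-minimal)
open import Data.Vec.Properties.WithK using ([]=-irrelevant)
open import Function using (_∘_; const)
open import Level using (0ℓ)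
open import Relation.Binary
  using (Rel; IsStrictTotalOrder; Symmetric; tri<; tri≈; tri>)
  renaming (Decidable to Decidable₂)
open import Relation.Binary.Construct.Closure.ReflexiveTransitive using (Star; _◅_)
  renaming (ε to [])
import Relation.Binary.Construct.Flip.EqAndOrd as Flip
open import Relation.Binary.PropositionalEquality
  using (_≡_; _≢_; refl; sym; trans; cong; subst; subst₂)
open import Relation.Nullary using (¬_; Dec; yes; no; contradiction; ¬?)
open import Relation.Nullary.Decidable
  using (from-yes; map′; decidable-stable; _×-dec_; _→-dec_)
open import Relation.Unary using (Pred; Decidable)

-- Extremal elements of decidable predicates on a finite total order.

module _ {k} {_<_ : Rel (Fin k) 0ℓ} (total : IsStrictTotalOrder _≡_ _<_) where

  private module < = IsStrictTotalOrder total

  greatest : {P : Pred (Fin k) 0ℓ} → Decidable P → ∃ P →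
             ∃ λ a → P a × (∀ {b} → P b → ¬ a < b)
  greatest {P} P? (a , Pa) = climb Pa (spo-noetherian <.isStrictPartialOrder a)
    where
    climb : ∀ {a} → P a → Acc (λ b a → a < b) a →
            ∃ λ a → P a × (∀ {b} → P b → ¬ a < b)
    climb {a} Pa (acc rs) with any? (λ b → P? b ×-dec (a <.<? b))
    ... | yes (b , Pb , a<b) = climb Pb (rs a<b)
    ... | no  a-max          = a , Pa , λ Pb a<b → a-max (_ , Pb , a<b)

module _ {k} {_<_ : Rel (Fin k) 0ℓ} (total : IsStrictTotalOrder _≡_ _<_) where

  least : {P : Pred (Fin k) 0ℓ} → Decidable P → ∃ P →
          ∃ λ a → P a × (∀ {b} → P b → ¬ b < a)
  least = greatest (Flip.isStrictTotalOrder total)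

-- EMC as a finite search over variables and values.

module _ {n d} (_~_ : Rel (Fin n × Fin d) 0ℓ)
         (_<X_ : Rel (Fin n) 0ℓ) (_<D_ : Rel (Fin d) 0ℓ) where

  -- Quantifying over finite sets instead of over maps between points makes the occurrence of EMC
  -- under fixed orders decidable.
  record EMCAt (x y z : Fin n) (ε α β γ δ : Fin d) : Set where
    constructor emc
    field
      x≢y : x ≢ y
      x≢z : x ≢ z
      y<z : y <X z
      β<α : β <D α
      δ<γ : δ <D γ
      α≁γ : ¬ (y , α) ~ (z , γ)
      ε≁δ : ¬ (x , ε) ~ (z , δ)
      α~δ : (y , α) ~ (z , δ)
      β~γ : (y , β) ~ (z , γ)
      α~ε : (y , α) ~ (x , ε)
      ε~γ : (x , ε) ~ (z , γ)

  Occurrence : Set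
  Occurrence = ∃ λ x → ∃ λ y → ∃ λ z → ∃ λ ε → ∃ λ α → ∃ λ β → ∃ λ γ → ∃ λ δ →
               EMCAt x y z ε α β γ δ

  occurrence? : Decidable₂ _~_ → Decidable₂ _<X_ → Decidable₂ _<D_ → Dec Occurrence
  occurrence? _~?_ _<X?_ _<D?_ =
    any? λ x → any? λ y → any? λ z →
    any? λ ε → any? λ α → any? λ β → any? λ γ → any? λ δ →
    map′ (λ (p , q , r , s , t , u , v , w , a , b , c) → emc p q r s t u v w a b c)
         (λ (emc p q r s t u v w a b c) → p , q , r , s , t , u , v , w , a , b , c)
         (¬? (x ≟ y) ×-dec ¬? (x ≟ z) ×-dec (y <X? z) ×-dec (β <D? α) ×-dec
          (δ <D? γ) ×-dec ¬? ((y , α) ~? (z , γ)) ×-dec ¬? ((x , ε) ~? (z , δ)) ×-dec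
          ((y , α) ~? (z , δ)) ×-dec ((y , β) ~? (z , γ)) ×-dec
          ((y , α) ~? (x , ε)) ×-dec ((x , ε) ~? (z , γ)))

-- The greedy solution of an arc consistent, EMC-free relation.

module Greedy
  {n d} {_<X_ : Rel (Fin n) 0ℓ} {_<D_ : Rel (Fin d) 0ℓ}
  (totalX : IsStrictTotalOrder _≡_ _<X_) (totalD : IsStrictTotalOrder _≡_ _<D_)
  {_~_ : Rel (Fin n × Fin d) 0ℓ} (_~?_ : Decidable₂ _~_) (~-sym : Symmetric _~_)
  (B : Fin n → Subset d) (B-nonempty : ∀ v → Nonempty (B v))
  (support : ∀ {v a} → a ∈ B v → ∀ w → w ≢ v → ∃ λ b → b ∈ B w × (v , a) ~ (w , b))
  (EMC-free : ¬ Occurrence _~_ _<X_ _<D_)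
  where

  private
    module X = IsStrictTotalOrder totalX
    module D = IsStrictTotalOrder totalD

  <⇒≢ : ∀ {v w} → v <X w → v ≢ w
  <⇒≢ v<w v≡w = X.irrefl v≡w v<w

  Assignment : Set
  Assignment = Fin n → Fin d

  ConsistentBelow : Assignment → Fin n → Pred (Fin d) 0ℓ
  ConsistentBelow s v a = a ∈ B v × (∀ m → m <X v → (m , s m) ~ (v , a))

  consistentBelow? : ∀ s v → Decidable (ConsistentBelow s v)
  consistentBelow? s v a =
    (a ∈? B v) ×-dec all? λ m → (m X.<? v) →-dec ((m , s m) ~? (v , a))

  -- `a` is kept apart from `s v` because it is found before `s` is changed at `v`.
  record IsGreedy (s : Assignment) (v : Fin n) (a : Fin d) : Set where
    field
      consistent : ConsistentBelow s v a
      maximal    : ∀ {b} → ConsistentBelow s v b → ¬ a <D b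

    blocked : ∀ {b} → b ∈ B v → a <D b → ∃ λ m → m <X v × ¬ (m , s m) ~ (v , b)
    blocked {b} b∈ a<b with any? (λ m → (m X.<? v) ×-dec ¬? ((m , s m) ~? (v , b)))
    ... | yes found = found
    ... | no  ¬found = contradiction a<b (maximal (b∈ , λ m m<v →
            decidable-stable ((m , s m) ~? (v , b)) λ m≁b → ¬found (m , m<v , m≁b)))

  open IsGreedy

  GreedyAt : Assignment → Fin n → Set
  GreedyAt s v = IsGreedy s v (s v)

  ConsistentBelow-resp : ∀ {s t v a} → (∀ m → m <X v → s m ≡ t m) →
                         ConsistentBelow s v a → ConsistentBelow t v a
  ConsistentBelow-resp {a = a} s≗t (a∈ , s~a) =
    a∈ , λ m m<v → subst (λ c → (m , c) ~ (_ , a)) (s≗t m m<v) (s~a m m<v)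

  IsGreedy-resp : ∀ {s t v a} → (∀ m → m <X v → s m ≡ t m) →
                  IsGreedy s v a → IsGreedy t v a
  IsGreedy-resp s≗t g = record
    { consistent = ConsistentBelow-resp s≗t (g .consistent)
    ; maximal    = λ c → g .maximal (ConsistentBelow-resp (λ m m<v → sym (s≗t m m<v)) c)
    }

  pairwise-compatible : ∀ {s} {P : Pred (Fin n) 0ℓ} → (∀ v → P v → GreedyAt s v) →
    ∀ {v w} → P v → P w → v ≢ w → (v , s v) ~ (w , s w)
  pairwise-compatible greedy {v} {w} Pv Pw v≢w with X.compare v w
  ... | tri< v<w _ _ = greedy w Pw .consistent .proj₂ v v<w
  ... | tri≈ _ v≡w _ = contradiction v≡w v≢w
  ... | tri> _ _ w<v = ~-sym (greedy v Pv .consistent .proj₂ w w<v)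

  -- The part of EMC other than β, with α = s(m) and γ = e: what is missing is
  -- a support of e at m below s(m).
  record Trap (s : Assignment) (m v : Fin n) (e : Fin d) : Set where
    field
      {w}   : Fin n
      {ε δ} : Fin d
      w≢m   : w ≢ m
      w≢v   : w ≢ v
      δ<e   : δ <D e
      ε≁δ   : ¬ (w , ε) ~ (v , δ)
      m~δ   : (m , s m) ~ (v , δ)
      m~ε   : (m , s m) ~ (w , ε)
      ε~e   : (w , ε) ~ (v , e)

  -- `b` in the role of β would complete the trap to EMC, with `m` as y and `v` as z.
  no-support-below : ∀ {s m v e b} → Trap s m v e → m <X v → ¬ (m , s m) ~ (v , e) →
                     (m , b) ~ (v , e) → ¬ b <D s m
  no-support-below t m<v m≁e b~e b<m =
    EMC-free (_ , _ , _ , _ , _ , _ , _ , _ ,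
              emc w≢m w≢v m<v b<m δ<e m≁e ε≁δ m~δ b~e m~ε ε~e)
    where open Trap t

  Trapped : Assignment → Fin n → Fin d → Set
  Trapped s v e = ∀ m → m <X v → ¬ (m , s m) ~ (v , e) → Trap s m v e

  module _ {s j} (greedy : ∀ m → m <X j → GreedyAt s m) where

    -- Induction on `k` with `v` and `e` free: the descent replaces them by `k` and `b`, but also
    -- returns to the same `v` and `e` at smaller variables. `v` may be `j` itself, where `s` is not
    -- yet known to be greedy.
    trapped⇒consistent : ∀ k → Acc _<X_ k → k <X j → ∀ {v e} → k <X v → e ∈ B v →
                         Trapped s v e → (k , s k) ~ (v , e)
    trapped⇒consistent k (acc rs) k<j {v} {e} k<v e∈ trapped =
      decidable-stable (_ ~? _) impossible
      where
      k-greedy = greedy k k<j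

      impossible : ¬ ¬ (k , s k) ~ (v , e)
      impossible k≁e with support e∈ k (<⇒≢ k<v)
      ... | b , b∈ , e~b with D.compare b (s k)
      ... | tri< b<k _ _ = no-support-below (trapped k k<v k≁e) k<v k≁e (~-sym e~b) b<k
      ... | tri≈ _ refl _ = k≁e (~-sym e~b)
      -- `b` lies above the greedy choice, so an earlier `m` blocks it; the induction hypothesis for
      -- `b` at `m` refutes this.
      ... | tri> _ _ k<b with blocked k-greedy b∈ k<b
      ... | m , m<k , m≁b =
        m≁b (trapped⇒consistent m (rs m<k) (X.trans m<k k<j) m<k b∈ b-trapped)
        where
        b-trapped : Trapped s k b
        -- The trap has w = v, ε = e and δ = s(k): `e` is compatible with `b` but not with `s k`.
        b-trapped l l<k _ = record
          { w≢m = λ v≡l → <⇒≢ l<v (sym v≡l)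
          ; w≢v = λ v≡k → <⇒≢ k<v (sym v≡k)
          ; δ<e = k<b
          ; ε≁δ = k≁e ∘ ~-sym
          ; m~δ = k-greedy .consistent .proj₂ l l<k
          -- `l` precedes `k`, so induction already makes `s l` compatible with `e`.
          ; m~ε = trapped⇒consistent l (rs l<k) (X.trans l<k k<j) l<v e∈ trapped
          ; ε~e = e~b
          }
          where l<v = X.trans l<k k<v

    Supports : Fin n → Pred (Fin d) 0ℓ
    Supports m c = c ∈ B j × (m , s m) ~ (j , c)

    supports? : ∀ m → Decidable (Supports m)
    supports? m c = (c ∈? B j) ×-dec ((m , s m) ~? (j , c))

    LeastSupport : Fin n → Pred (Fin d) 0ℓ
    LeastSupport m e = Supports m e × (∀ c → Supports m c → ¬ c <D e)

    leastSupport? : ∀ m → Decidable (LeastSupport m)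
    leastSupport? m e =
      supports? m e ×-dec all? λ c → supports? m c →-dec ¬? (c D.<? e)

    leastSupport : ∀ {m} → m <X j → ∃ (LeastSupport m)
    leastSupport {m} m<j =
      let c , c∈ , m~c = support (greedy m m<j .consistent .proj₁) j (<⇒≢ m<j ∘ sym)
          e , m~e , e-least = least totalD (supports? m) (c , c∈ , m~c)
      in e , m~e , λ _ → e-least

    consistent-value : ∃ (ConsistentBelow s j)
    consistent-value with any? (X._<? j)
    ... | no  none = let a , a∈ = B-nonempty j in
                     a , a∈ , λ m m<j → contradiction (m , m<j) none
    -- `e` is the greatest of the least supports and `i` a variable attaining it; `m` shows that
    -- there is one to choose from.
    ... | yes (m , m<j)
      with e , (i , i<j , (e∈ , i~e) , e-least) , e-greatest ←
        greatest totalD (λ e → any? λ m → (m X.<? j) ×-dec leastSupport? m e)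
          (let e , m-least = leastSupport m<j in e , m , m<j , m-least) =
      e , e∈ , λ k k<j → trapped⇒consistent k (spo-wellFounded X.isStrictPartialOrder k) k<j k<j e∈ trapped
      where
      trapped : Trapped s j e
      trapped m m<j m≁e = trap
        where
        trap : Trap s m j e
        trap with leastSupport m<j
        ... | c , m-least@((c∈ , m~c) , _) with D.compare c e
        ... | tri≈ _ refl _ = contradiction m~c m≁e
        ... | tri> _ _ e<c = contradiction e<c (e-greatest (m , m<j , m-least))
        -- The trap has w = i, ε = s(i) and δ = c: since `e` is the least support of `i`, the
        -- smaller `c` is incompatible with `s i`.
        ... | tri< c<e _ _ = record
          { w≢m = i≢m
          ; w≢v = <⇒≢ i<j
          ; δ<e = c<e
          ; ε≁δ = λ i~c → e-least c (c∈ , i~c) c<e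
          ; m~δ = m~c
          ; m~ε = pairwise-compatible greedy m<j i<j (i≢m ∘ sym)
          ; ε~e = i~e
          }
          where
          i≢m : i ≢ m
          i≢m refl = m≁e i~e

    greedy-value : ∃ (IsGreedy s j)
    greedy-value with greatest totalD (consistentBelow? s j) consistent-value
    ... | a , a-consistent , a-max = a , record
      { consistent = a-consistent ; maximal = a-max }

  -- Being greedy up to the greatest variable of `P` covers all of `P`. This serves both the
  -- variables before a given one, where the greatest is its predecessor, and the set of all
  -- variables.
  greedy-assignment : (P : Pred (Fin n) 0ℓ) → Decidable P →
    (∀ u → P u → ∃ λ s → ∀ v → ¬ u <X v → GreedyAt s v) →
    ∃ λ s → ∀ v → P v → GreedyAt s v
  greedy-assignment P P? up-to with any? P?
  ... | no  none = proj₁ ∘ B-nonempty , λ v Pv → contradiction (v , Pv) none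
  ... | yes some =
    let u , Pu , u-max = greatest totalX P? some
        s , s-greedy   = up-to u Pu
    in s , λ v Pv → s-greedy v (u-max Pv)

  -- Well-founded recursion on `u`; `¬ u <X v` says that `v` is at or before `u`.
  greedy-up-to : ∀ u → Acc _<X_ u → ∃ λ s → ∀ v → ¬ u <X v → GreedyAt s v
  greedy-up-to u (acc rs) = t , t-greedy
    where
    below = greedy-assignment (_<X u) (X._<? u) λ v v<u → greedy-up-to v (rs v<u)
    s = proj₁ below
    value = greedy-value (proj₂ below)

    -- Greediness at a variable looks only at earlier values, so changing the value at `u` keeps the
    -- variables before `u` greedy.
    t : Assignment
    t = updateAt s u (const (proj₁ value))

    t-agrees : ∀ {v} → v <X u → s v ≡ t v
    t-agrees v<u = sym (updateAt-minimal _ u s (<⇒≢ v<u))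

    t-greedy : ∀ v → ¬ u <X v → GreedyAt t v
    t-greedy v u≮v with X.compare v u
    ... | tri> _ _ u<v = contradiction u<v u≮v
    ... | tri≈ _ refl _ = subst (IsGreedy t u) (sym (updateAt-updates u s))
                            (IsGreedy-resp (λ m → t-agrees) (proj₂ value))
    ... | tri< v<u _ _ = subst (IsGreedy t v) (t-agrees v<u)
      (IsGreedy-resp (λ m m<v → t-agrees (X.trans m<v v<u)) (proj₂ below v v<u))

  solution : ∃ λ s → (∀ v → s v ∈ B v) × (∀ v w → v ≢ w → (v , s v) ~ (w , s w))
  solution =
    let s , s-greedy = greedy-assignment (λ _ → ⊤) (λ _ → yes tt)
                         λ u _ → greedy-up-to u (spo-wellFounded X.isStrictPartialOrder u)
    in s , (λ v → s-greedy v tt .consistent .proj₁) ,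
       λ v w → pairwise-compatible {P = λ _ → ⊤} s-greedy tt tt

-- Compatibility in an instance as a decidable relation on variable-value pairs.

module _ (I : Instance) where
  open Instance I

  -- The membership proofs are existential, so that the relation lives on plain pairs; it fails
  -- outside the domains.
  _~_ : Rel (Fin #vars × Fin #vals) 0ℓ
  (v , a) ~ (w , b) = ∃ λ (a∈ : a ∈ domain v) → ∃ λ (b∈ : b ∈ domain w) →
                      cpt (point v a a∈) (point w b b∈) ≡ just true

  -- Membership proofs are unique, so a point is determined by its variable and value.
  ~⇒cpt : ∀ {v w a b} {a∈ : a ∈ domain v} {b∈ : b ∈ domain w} → (v , a) ~ (w , b) →
          cpt (point v a a∈) (point w b b∈) ≡ just true
  ~⇒cpt {a∈ = a∈} {b∈} (a∈′ , b∈′ , eq)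
    rewrite []=-irrelevant a∈ a∈′ | []=-irrelevant b∈ b∈′ = eq

  ≁⇒cpt : ∀ {v w a b} {a∈ : a ∈ domain v} {b∈ : b ∈ domain w} → v ≢ w →
          ¬ (v , a) ~ (w , b) → cpt (point v a a∈) (point w b b∈) ≡ just false
  ≁⇒cpt {v} {w} {a} {b} {a∈} {b∈} v≢w a≁b
    with cpt (point v a a∈) (point w b b∈) in eq | cpt-total (point v a a∈) (point w b b∈) v≢w
  ... | just false | _ = refl
  ... | just true  | _ = contradiction (a∈ , b∈ , eq) a≁b

  ~-sym : Symmetric _~_
  ~-sym (a∈ , b∈ , eq) = b∈ , a∈ , trans (cpt-sym _ _) eq

  _~?_ : Decidable₂ _~_
  (v , a) ~? (w , b) with a ∈? domain v | b ∈? domain w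
  ... | no a∉  | _      = no (a∉ ∘ proj₁)
  ... | yes _  | no b∉  = no (b∉ ∘ proj₁ ∘ proj₂)
  ... | yes a∈ | yes b∈ =
    map′ (λ eq → a∈ , b∈ , eq) ~⇒cpt
         (Maybe.≡-dec Bool._≟_ (cpt (point v a a∈) (point w b b∈)) (just true))

  IsSolution : Pred (Fin #vars → Fin #vals) 0ℓ
  IsSolution s = (∀ v → s v ∈ domain v) × (∀ v w → v ≢ w → (v , s v) ~ (w , s w))

  isSolution? : Decidable IsSolution
  isSolution? s = (all? λ v → s v ∈? domain v) ×-dec
    (all? λ v → all? λ w → ¬? (v ≟ w) →-dec ((v , s v) ~? (w , s w)))

  IsSolution-resp : ∀ {s t} → (∀ v → s v ≡ t v) → IsSolution s → IsSolution t
  IsSolution-resp s≗t (s∈ , s~s) =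
    (λ v → subst (_∈ domain v) (s≗t v) (s∈ v)) ,
    (λ v w v≢w → subst₂ (λ a b → (v , a) ~ (w , b)) (s≗t v) (s≗t w) (s~s v w v≢w))

  isSolution⇒Solution : ∃ IsSolution → Solution I
  isSolution⇒Solution (s , s∈ , s~s) = record
    { s = s ; s∈ = s∈ ; compatible = λ v w v≢w → ~⇒cpt (s~s v w v≢w) }

  -- Assignments are coded by a finite set. Decoding returns an assignment only up to pointwise
  -- equality, hence `IsSolution-resp`.
  solution? : Dec (∃ IsSolution)
  solution? = map′ (λ (i , sol) → finToFun i , sol)
    (λ (s , sol) → funToFin s , IsSolution-resp (λ v → sym (finToFun-funToFin s v)) sol)
    (any? (isSolution? ∘ finToFun))

  removal-⊆ : ∀ {B C} → Star (_⟶_ I) B C → ∀ v → C v ⊆ B v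
  removal-⊆ [] v a∈ = a∈
  removal-⊆ {B} (remove p _ _ ◅ steps) v a∈ with removal-⊆ steps v a∈ | v ≟ var p
  ... | a∈′ | yes refl = p─q⊆p (B v) _ (subst (_ ∈_) (updateAt-updates v B) a∈′)
  ... | a∈′ | no  v≢p  = subst (_ ∈_) (updateAt-minimal v (var p) B v≢p) a∈′

  -- Homomorphisms from the pattern EMC to an ordered instance.

  module _ {_<X_ : Rel (Fin #vars) 0ℓ} {_<D_ : Rel (Fin #vals) 0ℓ}
           (totalX : IsStrictTotalOrder _≡_ _<X_) (totalD : IsStrictTotalOrder _≡_ _<D_)
           where

    homomorphism : Occurrence _~_ _<X_ _<D_ → Homomorphism EMC (equip I totalX totalD)
    homomorphism (vx , vy , vz , aε , aα , aβ , aγ , aδ ,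
                  emc x≢y x≢z y<z β<α δ<γ α≁γ ε≁δ
                      α~δ@(α∈ , δ∈ , _) (β∈ , γ∈ , β~γ) α~ε@(_ , ε∈ , _) ε~γ) = record
      { f         = image ∘ val
      ; f-cpt     = λ p q → image-cpt (val p) (val q)
      ; fvar      = fvar
      ; fvar-def  = λ p → trans (cong fvar (owner-var p)) (owner-image (val p))
      ; fvar-inj  = λ {u} {v} → fvar-inj u v
      ; fvar-mono = λ { EMC.y<z → y<z }
      ; f-mono    = λ { _ _ _ → image-mono }
      }
      where
      open EMC using (x; y; z; ε; α; β; γ; δ)

      -- The positive edges place all five values in their domains.
      image : Fin 5 → Point domain
      image ε = point vx aε ε∈
      image α = point vy aα α∈
      image β = point vy aβ β∈
      image γ = point vz aγ γ∈
      image δ = point vz aδ δ∈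

      fvar : Fin 3 → Fin #vars
      fvar x = vx
      fvar y = vy
      fvar z = vz

      -- The domains of the pattern are disjoint, so a value determines its variable.
      owner : Fin 5 → Fin 3
      owner ε = x
      owner α = y
      owner β = y
      owner γ = z
      owner δ = z

      owner-image : ∀ a → fvar (owner a) ≡ var (image a)
      owner-image ε = refl
      owner-image α = refl
      owner-image β = refl
      owner-image γ = refl
      owner-image δ = refl

      owner-var : (p : Point EMC.domain) → var p ≡ owner (val p)
      owner-var (point v a a∈) =
        from-yes (all? λ v → all? λ a → (a ∈? EMC.domain v) →-dec (v ≟ owner a)) v a a∈

      y≢z : vy ≢ vz
      y≢z vy≡vz = IsStrictTotalOrder.irrefl totalX vy≡vz y<z

      fvar-inj : ∀ u v → fvar u ≡ fvar v → u ≡ v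
      fvar-inj x x _  = refl
      fvar-inj y y _  = refl
      fvar-inj z z _  = refl
      fvar-inj x y eq = contradiction eq x≢y
      fvar-inj y x eq = contradiction (sym eq) x≢y
      fvar-inj x z eq = contradiction eq x≢z
      fvar-inj z x eq = contradiction (sym eq) x≢z
      fvar-inj y z eq = contradiction eq y≢z
      fvar-inj z y eq = contradiction (sym eq) y≢z

      image-cpt : ∀ a b {t} → EMC.edge a b ≡ just t → cpt (image a) (image b) ≡ just t
      image-cpt α γ refl = ≁⇒cpt y≢z α≁γ
      image-cpt γ α refl = ≁⇒cpt (y≢z ∘ sym) (α≁γ ∘ ~-sym)
      image-cpt ε δ refl = ≁⇒cpt x≢z ε≁δ
      image-cpt δ ε refl = ≁⇒cpt (x≢z ∘ sym) (ε≁δ ∘ ~-sym)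
      image-cpt α δ refl = ~⇒cpt α~δ
      image-cpt δ α refl = ~⇒cpt (~-sym α~δ)
      image-cpt β γ refl = β~γ
      image-cpt γ β refl = trans (cpt-sym _ _) β~γ
      image-cpt α ε refl = ~⇒cpt α~ε
      image-cpt ε α refl = ~⇒cpt (~-sym α~ε)
      image-cpt ε γ refl = ~⇒cpt ε~γ
      image-cpt γ ε refl = ~⇒cpt (~-sym ε~γ)

      image-mono : ∀ {a b} → a EMC.<D b → val (image a) <D val (image b)
      image-mono EMC.β<α = β<α
      image-mono EMC.δ<γ = δ<γ

theorem3p1 : AC-Decides (CSP-SP EMC)
theorem3p1 I ¬occurs B (removals , ac) B-nonempty =
  -- Solvability is decidable, so the absence of solutions may be assumed. Then EMC occurs under
  -- every pair of orders, as an EMC-free pair would give the greedy solution; this contradicts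
  -- `¬occurs`.
  isSolution⇒Solution I (decidable-stable (solution? I) λ unsolvable →
    ¬occurs λ totalX totalD → homomorphism I totalX totalD
      (decidable-stable
        (occurrence? (_~_ I) _ _ (_~?_ I)
          (IsStrictTotalOrder._<?_ totalX) (IsStrictTotalOrder._<?_ totalD))
        λ EMC-free →
          let s , s∈ , s~s = Greedy.solution totalX totalD (_~?_ I) (~-sym I) B
                               B-nonempty support EMC-free
          in unsolvable (s , (λ v → B⊆domain v (s∈ v)) , s~s)))
  where
  open Instance I

  B⊆domain : ∀ v → B v ⊆ domain v
  B⊆domain = removal-⊆ I removals

  support : ∀ {v a} → a ∈ B v → ∀ w → w ≢ v → ∃ λ b → b ∈ B w × _~_ I (v , a) (w , b)
  support {v} {a} a∈ w w≢v with ac (point v a (B⊆domain v a∈)) a∈ w w≢v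
  ... | point .w b b∈ , refl , b∈B , a~b = b , b∈B , B⊆domain v a∈ , b∈ , a~b
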